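{- Let $d\geq 2$ be an integer. The competitive ratio of the \textsc{Ranking} algorithm for online bipartite matching on $d$-regular bipartite graphs is at most $$\gamma(d)=1-\frac{d-1}{2d-1}\cdot\left(1-\frac{1}{d}\right)^d .$$
   Context: Online bipartite matching: a bipartite graph $G=(S\cup R,E)$ has offline vertices $S$ (servers), known in advance, and online vertices $R$ (requests) that arrive one at a time in an adversarially chosen order. When a request $r$ arrives, its neighbor set $N(r)\subseteq S$ is revealed, and the algorithm must irrevocably either match $r$ to a currently unmatched neighbor or leave $r$ unmatched forever. $\mathsf{ALG}$ is the size of the matching produced and $\mathsf{OPT}$ the size of a maximum matching of $G$. The competitive ratio of a (possibly randomized) algorithm on a class of instances is the infimum over all instances in the class of $\mathbb{E}[\mathsf{ALG}]/\mathsf{OPT}$. A bipartite graph is $d$-regular if every server and every request has degree exactly $d$. The \textsc{Ranking} algorithm: each server $s$ independently draws a rank $y_s$ uniformly from $[0,1]$; each arriving request is matched to its unmatched neighbor with the smallest rank, if any unmatched neighbor exists. -}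

module Defs where

open import Data.Nat as ℕ using (ℕ; zero; suc; _<ᵇ_)
open import Data.Fin using (Fin; zero; suc; toℕ)
open import Data.Fin.Properties using (_≟_)
open import Data.Bool using (Bool; true; false; not; _∧_; _∨_; if_then_else_)
open import Data.Maybe using (Maybe; just; nothing; is-just)
open import Data.List using (List; []; _∷_; map; length; allFin; concatMap; filterᵇ)
open import Data.Bool.ListAction using (and)
open import Data.Nat.ListAction using (sum)
open import Data.Integer using (+_)
open import Data.Rational using (ℚ; _/_; 1ℚ; _-_; _*_)
open import Data.Product using (Σ; _×_; ∃)
open import Relation.Binary.PropositionalEquality using (_≡_)
open import Relation.Nullary.Decidable using (⌊_⌋)

countTrue : List Bool → ℕ
countTrue []          = 0
countTrue (true ∷ bs) = suc (countTrue bs)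
countTrue (false ∷ bs) = countTrue bs

-- A bipartite instance: n servers (offline), m requests (online).
-- Requests arrive in index order 0,1,...,m-1 (the adversarial order is
-- encoded by the labelling of the requests).  adj r s = true iff {r,s} ∈ E.
record Instance : Set where
  field
    n   : ℕ
    m   : ℕ
    adj : Fin m → Fin n → Bool
open Instance public

degReq : (G : Instance) → Fin (m G) → ℕ
degReq G r = countTrue (map (adj G r) (allFin (n G)))

degServ : (G : Instance) → Fin (n G) → ℕ
degServ G s = countTrue (map (λ r → adj G r s) (allFin (m G)))

IsRegular : ℕ → Instance → Set
IsRegular d G = ((r : Fin (m G)) → degReq G r ≡ d) × ((s : Fin (n G)) → degServ G s ≡ d)

IsMatching : (G : Instance) → (Fin (m G) → Maybe (Fin (n G))) → Set
IsMatching G M =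
  ((r : Fin (m G)) (s : Fin (n G)) → M r ≡ just s → adj G r s ≡ true) ×
  ((r r' : Fin (m G)) (s : Fin (n G)) → M r ≡ just s → M r' ≡ just s → r ≡ r')

matchingSize : (G : Instance) → (Fin (m G) → Maybe (Fin (n G))) → ℕ
matchingSize G M = countTrue (map (λ r → is-just (M r)) (allFin (m G)))

IsOPT : Instance → ℕ → Set
IsOPT G k =
  (Σ (Fin (m G) → Maybe (Fin (n G))) λ M → IsMatching G M × matchingSize G M ≡ k) ×
  ((M : Fin (m G) → Maybe (Fin (n G))) → IsMatching G M → matchingSize G M ℕ.≤ k)

-- Ranking.  Since the ranks y_s are i.i.d. uniform on [0,1], ties have
-- probability 0 and the relative order of the ranks is a uniformly random
-- bijection ρ : servers → {0,...,n-1}.  Hence E[ALG] is the average of the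
-- deterministic run over all bijections ρ (ρ s = relative rank of s).

allFuns : (k j : ℕ) → List (Fin k → Fin j)
allFuns zero    j = (λ ()) ∷ []
allFuns (suc k) j =
  concatMap (λ f → map (λ x → λ { zero → x ; (suc i) → f i }) (allFin j)) (allFuns k j)

isInjective : {k : ℕ} → (Fin k → Fin k) → Bool
isInjective {k} f =
  and (map (λ i → and (map (λ j → ⌊ i ≟ j ⌋ ∨ not ⌊ f i ≟ f j ⌋) (allFin k))) (allFin k))

rankOrders : (k : ℕ) → List (Fin k → Fin k)
rankOrders k = filterᵇ isInjective (allFuns k k)

pickMin : {k : ℕ} → (Fin k → Fin k) → (Fin k → Bool) → Maybe (Fin k)
pickMin {k} ρ cand = go (allFin k)
  where
  go : List (Fin k) → Maybe (Fin k)
  go [] = nothing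
  go (s ∷ ss) with go ss
  ... | nothing = if cand s then just s else nothing
  ... | just b  = if cand s ∧ (toℕ (ρ s) <ᵇ toℕ (ρ b)) then just s else just b

rankingALG : (G : Instance) → (Fin (n G) → Fin (n G)) → ℕ
rankingALG G ρ = run (λ _ → false) (allFin (m G))
  where
  run : (Fin (n G) → Bool) → List (Fin (m G)) → ℕ
  run matched [] = 0
  run matched (r ∷ rs) with pickMin ρ (λ s → adj G r s ∧ not (matched s))
  ... | nothing = run matched rs
  ... | just s  = suc (run (λ t → ⌊ t ≟ s ⌋ ∨ matched t) rs)

-- sum over all rank orders of ALG; E[ALG] = totalALG G / numOrders G
totalALG : Instance → ℕ
totalALG G = sum (map (rankingALG G) (rankOrders (n G)))

numOrders : Instance → ℕ
numOrders G = length (rankOrders (n G))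

fromℕ : ℕ → ℚ
fromℕ k = + k / 1

powℚ : ℚ → ℕ → ℚ
powℚ q zero    = 1ℚ
powℚ q (suc e) = q * powℚ q e

-- γ(d) = 1 - (d-1)/(2d-1) * (1 - 1/d)^d ; written for d = suc k:
-- (d-1)/(2d-1) = k/(2k+1), 1 - 1/d = k/(k+1).  γ 0 is a junk value (unused).
γ : ℕ → ℚ
γ zero    = 1ℚ
γ (suc k) = 1ℚ - ((+ k / suc (2 ℕ.* k)) * powℚ (+ k / suc k) (suc k))

{-# OPTIONS --safe #-}

-- Write d = k + 1.  The hard instance has servers B₁ … B_k and A₀ … A_k.  First
-- come d requests, the i-th adjacent to A_i and to every B; then k requests,
-- each adjacent to every A.  A server B left free by the early requests stays
-- free forever, so ALG ≤ (2d − 1) − U, where U is the number of such servers.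
--
-- The early requests use up the B's in increasing order of rank: if j of them
-- are gone, request i takes another B exactly when more than j of the B's have
-- rank below that of A_i.  Hence the number J of used B's obeys
-- J ← J + [J < c_i] with c_i = #{b : ρ b < ρ A_i}.
--
-- Fix the ranks and let A_i swap its rank with each x in C = B ∪ {A_i} in turn,
-- which preserves the uniform distribution.  Let J* be the value of J after the
-- requests before i if all of C were available.  Leaving x out of C can only
-- decrease J, and request i, given the rank of x, takes a B only if more than
-- J* elements of C lie below x, which holds for at most k − J* ≤ U of the d
-- choices of x.  So request i decreases E U by at most E U / d, whence
-- E U ≥ k (1 − 1/d)^d after all d early requests.
module Submission where

open import Defs
open import Data.Bool using (Bool; true; false; not; _∧_; _∨_; if_then_else_)
open import Data.Bool.ListAction using (and)
open import Data.Bool.Properties using (⇔→≡)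
open import Data.Fin using (Fin; zero; suc; toℕ; lift; splitAt; _↑ˡ_; _↑ʳ_)
import Data.Fin.Permutation as Perm
open import Data.Fin.Permutation.Components using (transpose; transpose-inverse)
open import Data.Fin.Properties
  using (_≟_; punchInᵢ≢i; toℕ-injective; splitAt-↑ˡ; splitAt-↑ʳ; splitAt⁻¹-↑ˡ; splitAt⁻¹-↑ʳ; ↑ˡ-injective; ↑ʳ-injective)
import Data.Integer as ℤ
import Data.Integer.Properties as ℤ
open import Data.List
  using (List; []; _∷_; _++_; map; allFin; tabulate; length; concatMap; filterᵇ; reverse; _ʳ++_)
open import Data.List.Membership.Propositional using (_∈_)
open import Data.List.Membership.Propositional.Properties using (∈-allFin)
open import Data.List.Properties
  using (map-tabulate; map-++; map-cong; map-∘; map-cong-local; length-reverse; length-tabulate)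
open import Data.List.Relation.Binary.Permutation.Propositional using (↭-sym; ↭⇒↭ₛ)
open import Data.List.Relation.Binary.Permutation.Propositional.Properties using (↭-reverse)
open import Data.List.Relation.Unary.All as All using (All; []; _∷_)
open import Data.List.Relation.Unary.AllPairs using ([]; _∷_)
open import Data.List.Relation.Unary.Any using (here; there)
open import Data.List.Relation.Unary.Unique.Propositional using (Unique)
open import Data.List.Relation.Unary.Unique.Propositional.Properties using (allFin⁺)
open import Data.Maybe using (Maybe; just; nothing; is-just)
open import Data.Maybe.Properties using (just-injective)
open import Data.Nat as ℕ using (ℕ; zero; suc)
import Data.Nat.ListAction as List
open import Data.Nat.ListAction.Properties using (sum-++)
import Data.Nat.Properties as ℕ
open import Data.Product using (Σ; ∃; _×_; _,_)
import Data.Rational.Properties as ℚ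
open import Data.Rational.Unnormalised as ℚᵘ using (mkℚᵘ; *≡*; *≤*)
import Data.Rational.Unnormalised.Properties as ℚᵘ
open import Data.Sum using (_⊎_; inj₁; inj₂)
open import Data.Vec.Functional as Vector using (removeAt)
open import Function using (_∘_; id; Injective; mk⇔)
open import Relation.Binary.PropositionalEquality hiding (J)
open import Relation.Nullary using (Dec; yes; no; ¬_; does; contradiction)
open import Relation.Nullary.Decidable using (⌊_⌋; isYes≗does; dec-true; dec-false)

-- Counting with Boolean predicates on finite sets.

module Counting where

  open import Data.Nat using (_+_; _*_; _≤_; _<_; z≤n; s≤s; _<ᵇ_; _<?_)
  open import Data.Nat.Properties hiding (_≟_)
  open import Algebra.Properties.CommutativeMonoid.Sum +-0-commutativeMonoid public
    using (sum; sum-cong-≗; sum-remove; ∑-distrib-+; ∑-comm; sum-permute)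

  ⟦_⟧ : Bool → ℕ
  ⟦ b ⟧ = if b then 1 else 0

  # : ∀ {n} → (Fin n → Bool) → ℕ
  # p = sum (⟦_⟧ ∘ p)

  #-cong : ∀ {n} {p q : Fin n → Bool} → p ≗ q → # p ≡ # q
  #-cong p≗q = sum-cong-≗ (cong ⟦_⟧ ∘ p≗q)

  ⟦b⟧≤1 : ∀ b → ⟦ b ⟧ ≤ 1
  ⟦b⟧≤1 true  = s≤s z≤n
  ⟦b⟧≤1 false = z≤n

  ⟦b⟧+⟦not-b⟧≡1 : ∀ b → ⟦ b ⟧ + ⟦ not b ⟧ ≡ 1
  ⟦b⟧+⟦not-b⟧≡1 true  = refl
  ⟦b⟧+⟦not-b⟧≡1 false = refl

  ⟦⟧-mono : ∀ a b → (a ≡ true → b ≡ true) → ⟦ a ⟧ ≤ ⟦ b ⟧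
  ⟦⟧-mono true  b a⇒b rewrite a⇒b refl = ≤-refl
  ⟦⟧-mono false b a⇒b = z≤n

  sum-mono-≤ : ∀ {n} {f g : Fin n → ℕ} → (∀ i → f i ≤ g i) → sum f ≤ sum g
  sum-mono-≤ {zero}  f≤g = z≤n
  sum-mono-≤ {suc n} f≤g = +-mono-≤ (f≤g zero) (sum-mono-≤ (f≤g ∘ suc))

  sum-const : ∀ n c → sum {n} (λ _ → c) ≡ n * c
  sum-const zero    c = refl
  sum-const (suc n) c = cong (c +_) (sum-const n c)

  #-true : ∀ n → # {n} (λ _ → true) ≡ n
  #-true n = trans (sum-const n 1) (*-identityʳ n)

  #-false : ∀ n → # {n} (λ _ → false) ≡ 0
  #-false n = trans (sum-const n 0) (*-zeroʳ n)

  #-disjoint : ∀ {n} (p q : Fin n → Bool) → (∀ i → ⟦ p i ⟧ + ⟦ q i ⟧ ≤ 1) → # p + # q ≤ n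
  #-disjoint {n} p q disjoint = begin
    # p + # q                        ≡⟨ ∑-distrib-+ (⟦_⟧ ∘ p) (⟦_⟧ ∘ q) ⟨
    sum (λ i → ⟦ p i ⟧ + ⟦ q i ⟧)    ≤⟨ sum-mono-≤ disjoint ⟩
    sum {n} (λ _ → 1)                ≡⟨ #-true n ⟩
    n                                ∎
    where open ≤-Reasoning

  #-complement : ∀ {n} (p : Fin n → Bool) → # p + # (not ∘ p) ≡ n
  #-complement {n} p = begin
    # p + # (not ∘ p)                      ≡⟨ ∑-distrib-+ (⟦_⟧ ∘ p) (⟦_⟧ ∘ not ∘ p) ⟨
    sum (λ i → ⟦ p i ⟧ + ⟦ not (p i) ⟧)    ≡⟨ sum-cong-≗ (⟦b⟧+⟦not-b⟧≡1 ∘ p) ⟩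
    sum {n} (λ _ → 1)                      ≡⟨ #-true n ⟩
    n                                      ∎
    where open ≡-Reasoning

  #≤n : ∀ {n} (p : Fin n → Bool) → # p ≤ n
  #≤n p = subst (# p ≤_) (#-complement p) (m≤m+n (# p) _)

  #-mono : ∀ {n} {p q : Fin n → Bool} → (∀ i → p i ≡ true → q i ≡ true) → # p ≤ # q
  #-mono {p = p} {q} p⇒q = sum-mono-≤ (λ i → ⟦⟧-mono (p i) (q i) (p⇒q i))

  #-insert : ∀ {n} {p q : Fin n → Bool} s → p s ≡ false → q s ≡ true →
             (∀ t → t ≢ s → q t ≡ p t) → # q ≡ suc (# p)
  #-insert {suc n} {p} {q} s ps qs agree = begin
    # q                                        ≡⟨ sum-remove {i = s} (⟦_⟧ ∘ q) ⟩
    ⟦ q s ⟧ + sum (removeAt (⟦_⟧ ∘ q) s)       ≡⟨ cong₂ (λ b x → ⟦ b ⟧ + x) qs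
                                                    (sum-cong-≗ λ t → cong ⟦_⟧ (agree _ (punchInᵢ≢i s t))) ⟩
    suc (sum (removeAt (⟦_⟧ ∘ p) s))           ≡⟨ cong (λ b → suc (⟦ b ⟧ + sum (removeAt (⟦_⟧ ∘ p) s))) ps ⟨
    suc (⟦ p s ⟧ + sum (removeAt (⟦_⟧ ∘ p) s)) ≡⟨ cong suc (sum-remove {i = s} (⟦_⟧ ∘ p)) ⟨
    suc (# p)                                  ∎
    where open ≡-Reasoning

  #-singleton : ∀ {n} {p : Fin n → Bool} s → p s ≡ true → (∀ t → t ≢ s → p t ≡ false) → # p ≡ 1
  #-singleton {n} s ps unique = trans (#-insert {p = λ _ → false} s refl ps unique) (cong suc (#-false n))

  sum-split : ∀ m {n} (f : Fin (m + n) → ℕ) → sum f ≡ sum (λ i → f (i ↑ˡ n)) + sum (λ j → f (m ↑ʳ j))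
  sum-split zero    f = refl
  sum-split (suc m) f = trans (cong (f zero +_) (sum-split m (f ∘ suc))) (sym (+-assoc (f zero) _ _))

  countTrue-tabulate : ∀ {n} (p : Fin n → Bool) → countTrue (tabulate p) ≡ # p
  countTrue-tabulate {zero}  p = refl
  countTrue-tabulate {suc n} p with p zero
  ... | true  = cong suc (countTrue-tabulate (p ∘ suc))
  ... | false = countTrue-tabulate (p ∘ suc)

  countTrue-allFin : ∀ {n} (p : Fin n → Bool) → countTrue (map p (allFin n)) ≡ # p
  countTrue-allFin p = trans (cong countTrue (map-tabulate id p)) (countTrue-tabulate p)

  ⌊⌋-true : ∀ {P : Set} (P? : Dec P) → P → ⌊ P? ⌋ ≡ true
  ⌊⌋-true P? p = trans (isYes≗does P?) (dec-true P? p)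

  ⌊⌋-false : ∀ {P : Set} (P? : Dec P) → ¬ P → ⌊ P? ⌋ ≡ false
  ⌊⌋-false P? ¬p = trans (isYes≗does P?) (dec-false P? ¬p)

  <ᵇ-true : ∀ {m n} → m < n → (m <ᵇ n) ≡ true
  <ᵇ-true {m} {n} = dec-true (m <? n)

  <ᵇ-false : ∀ {m n} → n ≤ m → (m <ᵇ n) ≡ false
  <ᵇ-false {m} {n} n≤m = dec-false (m <? n) (≤⇒≯ n≤m)

  <ᵇ-true⁻¹ : ∀ {m n} → (m <ᵇ n) ≡ true → m < n
  <ᵇ-true⁻¹ {m} {n} eq with m <? n
  ... | yes m<n = m<n
  ... | no  m≮n = contradiction (trans (sym eq) (dec-false (m <? n) m≮n)) λ ()

-- The recursion for the number of used B's, and the exchange inequality.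

module ServedCount where

  open Counting
  open import Data.Nat using (_+_; _*_; _∸_; _≤_; _<_; z≤n; s≤s; s≤s⁻¹; _<ᵇ_; _<?_)
  open import Data.Nat.Properties hiding (_≟_)

  below : ∀ {n} → (Fin n → ℕ) → ℕ → ℕ
  below w a = # (λ i → w i <ᵇ a)

  step : ℕ → ℕ → ℕ
  step c j = j + ⟦ j <ᵇ c ⟧

  -- The head of the list is the latest request: the recursion treats the tail first. Lists of past
  -- requests are therefore kept latest first.
  served : List ℕ → ℕ
  served []       = 0
  served (c ∷ cs) = step c (served cs)

  step-< : ∀ {c j} → j < c → step c j ≡ suc j
  step-< {c} {j} j<c rewrite <ᵇ-true j<c = +-comm j 1

  step-≥ : ∀ {c j} → c ≤ j → step c j ≡ j
  step-≥ {c} {j} c≤j rewrite <ᵇ-false c≤j = +-identityʳ j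

  j≤step : ∀ c j → j ≤ step c j
  j≤step c j = m≤m+n j _

  step≤ : ∀ {c j b} → c ≤ b → j ≤ b → step c j ≤ b
  step≤ {c} {j} c≤b j≤b with j <? c
  ... | yes j<c rewrite step-< j<c       = ≤-trans j<c c≤b
  ... | no  j≮c rewrite step-≥ (≮⇒≥ j≮c) = j≤b

  ≤step : ∀ {c j x} → x ≤ c → x ≤ suc j → x ≤ step c j
  ≤step {c} {j} x≤c x≤1+j with j <? c
  ... | yes j<c rewrite step-< j<c       = x≤1+j
  ... | no  j≮c rewrite step-≥ (≮⇒≥ j≮c) = ≤-trans x≤c (≮⇒≥ j≮c)

  -- A larger `j` may switch the increment off, yet `step c j` is the minimum of `suc j` and the
  -- larger of `j` and `c`, which is monotone in both arguments.
  step-mono : ∀ {c c′ j j′} → c ≤ c′ → j ≤ j′ → step c j ≤ step c′ j′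
  step-mono {c} {c′} {j} {j′} c≤c′ j≤j′ with j <? c
  ... | yes j<c rewrite step-< j<c       = ≤step (≤-trans j<c c≤c′) (s≤s j≤j′)
  ... | no  j≮c rewrite step-≥ (≮⇒≥ j≮c) = ≤-trans j≤j′ (j≤step c′ j′)

  served-below≤ : ∀ {n} (w : Fin n → ℕ) as → served (map (below w) as) ≤ n
  served-below≤ w []       = z≤n
  served-below≤ w (a ∷ as) = step≤ {c = below w a} (#≤n _) (served-below≤ w as)

  minimal-satisfying : ∀ {n} (v : Fin n → ℕ) (p : Fin n → Bool) →
    (∀ i → p i ≡ false) ⊎ (∃ λ i → p i ≡ true × (∀ j → p j ≡ true → v i ≤ v j))
  minimal-satisfying {zero}  v p = inj₁ λ ()
  minimal-satisfying {suc n} v p with minimal-satisfying (v ∘ suc) (p ∘ suc) | p zero in p0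
  ... | inj₁ none             | false = inj₁ λ { zero → p0 ; (suc i) → none i }
  ... | inj₁ none             | true  = inj₂ (zero , p0 , λ where
        zero    _  → ≤-refl
        (suc j) pj → contradiction (trans (sym pj) (none j)) λ ())
  ... | inj₂ (i , pi , least) | false = inj₂ (suc i , pi , λ where
        zero    p0′ → contradiction (trans (sym p0′) p0) λ ()
        (suc j) pj  → least j pj)
  ... | inj₂ (i , pi , least) | true with ≤-total (v zero) (v (suc i))
  ...   | inj₁ v0≤vi = inj₂ (zero , p0 , λ where
          zero    _  → ≤-refl
          (suc j) pj → ≤-trans v0≤vi (least j pj))
  ...   | inj₂ vi≤v0 = inj₂ (suc i , pi , λ where
          zero    _  → vi≤v0
          (suc j) pj → least j pj)

  -- The elements below a minimal element of rank > t all have rank ≤ t.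
  #-rank> : ∀ {n} (v : Fin n → ℕ) t → # (λ x → t <ᵇ below v (v x)) ≤ n ∸ suc t
  #-rank> {n} v t with minimal-satisfying v (λ x → t <ᵇ below v (v x))
  ... | inj₁ none = subst (_≤ n ∸ suc t) (sym (trans (#-cong none) (#-false n))) z≤n
  ... | inj₂ (x₀ , t<r , least) = m+n≤o⇒m≤o∸n _ (begin
    # high + suc t             ≤⟨ +-monoʳ-≤ (# high) (<ᵇ-true⁻¹ t<r) ⟩
    # high + below v (v x₀)    ≤⟨ #-disjoint high (λ y → v y <ᵇ v x₀) disjoint ⟩
    n                          ∎)
    where
    open ≤-Reasoning
    high = λ x → t <ᵇ below v (v x)
    disjoint : ∀ y → ⟦ high y ⟧ + ⟦ v y <ᵇ v x₀ ⟧ ≤ 1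
    disjoint y with high y in eq
    ... | true rewrite <ᵇ-false (least y eq) = ≤-refl
    ... | false = ⟦b⟧≤1 _

  -- w x lists the values of v with the x-th one left out.
  module Exchange {k : ℕ} (v : Fin (suc k) → ℕ) (w : Fin (suc k) → Fin k → ℕ)
    (below-w : ∀ x a → below v a ≡ ⟦ v x <ᵇ a ⟧ + below (w x) a) where

    private
      J : List ℕ → ℕ
      J as = served (map (below v) as)

      Jw : Fin (suc k) → List ℕ → ℕ
      Jw x as = served (map (below (w x)) as)

      below-w≤ : ∀ x a → below (w x) a ≤ below v a
      below-w≤ x a rewrite below-w x a = m≤n+m _ _

      -- `v x` is not below itself, so leaving it out does not change its rank.
      rank-w : ∀ x → below (w x) (v x) ≡ below v (v x)
      rank-w x rewrite below-w x (v x) | <ᵇ-false {v x} ≤-refl = refl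

      rank-< : ∀ x {a} → v x < a → below v (v x) < below v a
      rank-< x {a} x<a = begin-strict
        below v (v x)               ≡⟨ rank-w x ⟨
        below (w x) (v x)           ≤⟨ #-mono {p = λ i → w x i <ᵇ v x} (λ i → <ᵇ-true ∘ (λ i<x → <-trans i<x x<a) ∘ <ᵇ-true⁻¹) ⟩
        below (w x) a               <⟨ n<1+n _ ⟩
        suc (below (w x) a)         ≡⟨ cong (λ b → ⟦ b ⟧ + below (w x) a) (<ᵇ-true x<a) ⟨
        ⟦ v x <ᵇ a ⟧ + below (w x) a ≡⟨ below-w x a ⟨
        below v a                   ∎
        where open ≤-Reasoning

      Jw≤J : ∀ x as → Jw x as ≤ J as
      Jw≤J x []       = z≤n
      Jw≤J x (a ∷ as) = step-mono (below-w≤ x a) (Jw≤J x as)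

      -- Once `Jw` reaches the rank of `v x` it stays there, since it never decreases. Until then it
      -- keeps up with `J`: a request `a` with `v x ≥ a` sees the same count in both runs; if
      -- `v x < a`, either `Jw` grows by one, the most that `J` can grow, or `Jw` is already at
      -- least `below (w x) a`, hence at least the rank of `v x`.
      J⊓rank≤Jw : ∀ x as → below v (v x) ≤ Jw x as ⊎ J as ≤ Jw x as
      J⊓rank≤Jw x []       = inj₂ z≤n
      J⊓rank≤Jw x (a ∷ as) with J⊓rank≤Jw x as
      ... | inj₁ r≤j = inj₁ (≤-trans r≤j (j≤step (below (w x) a) (Jw x as)))
      ... | inj₂ J≤j with v x <? a
      ...   | no  x≮a = inj₂ (step-mono (≤-reflexive below-v≡) J≤j)
        where
        below-v≡ : below v a ≡ below (w x) a
        below-v≡ = trans (below-w x a) (cong (λ b → ⟦ b ⟧ + below (w x) a) (<ᵇ-false (≮⇒≥ x≮a)))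
      ...   | yes x<a with Jw x as <? below (w x) a
      ...     | yes j<c rewrite step-< j<c =
        inj₂ (≤-trans (+-mono-≤ J≤j (⟦b⟧≤1 (J as <ᵇ below v a))) (≤-reflexive (+-comm _ 1)))
      ...     | no  j≮c rewrite step-≥ (≮⇒≥ j≮c) = inj₁ (≤-trans rank≤c (≮⇒≥ j≮c))
        where
        rank≤c : below v (v x) ≤ below (w x) a
        rank≤c = s≤s⁻¹ (subst (below v (v x) <_)
          (trans (below-w x a) (cong (λ b → ⟦ b ⟧ + below (w x) a) (<ᵇ-true x<a))) (rank-< x x<a))

      -- A further request at `v x` is served only if `Jw` is less than its rank. This excludes the
      -- first alternative of `J⊓rank≤Jw`, so `J ≤ Jw` lies below the rank as well.
      served⇒high : ∀ x as → (Jw x as <ᵇ below (w x) (v x)) ≡ true → (J as <ᵇ below v (v x)) ≡ true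
      served⇒high x as eq with subst (Jw x as <_) (rank-w x) (<ᵇ-true⁻¹ eq) | J⊓rank≤Jw x as
      ... | j<r | inj₁ r≤j = contradiction j<r (≤⇒≯ r≤j)
      ... | j<r | inj₂ J≤j = <ᵇ-true (≤-<-trans J≤j j<r)

    -- The comparison passes through `J as`, which does not depend on the value left out: it limits
    -- how many `x` have high rank, and `k ∸ J as` is a lower bound for every term on the right.
    exchange : ∀ as → suc k * # (λ x → Jw x as <ᵇ below (w x) (v x)) ≤ sum (λ y → k ∸ Jw y as)
    exchange as = begin
      suc k * # (λ x → Jw x as <ᵇ below (w x) (v x))  ≤⟨ *-monoʳ-≤ (suc k) (#-mono λ x → served⇒high x as) ⟩
      -- The bound `suc k ∸ suc (J as)` on the number of high ranks computes to `k ∸ J as`.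
      suc k * # (λ x → J as <ᵇ below v (v x))         ≤⟨ *-monoʳ-≤ (suc k) (#-rank> v (J as)) ⟩
      suc k * (k ∸ J as)                              ≡⟨ sum-const (suc k) (k ∸ J as) ⟨
      sum {suc k} (λ _ → k ∸ J as)                    ≤⟨ sum-mono-≤ (λ y → ∸-monoʳ-≤ k (Jw≤J y as)) ⟩
      sum (λ y → k ∸ Jw y as)                         ∎
      where open ≤-Reasoning

-- Sums over all rank orders and their invariance under transpositions.

module Totals where

  open Counting
  open import Data.Nat using (_+_; _*_; _≤_; z≤n)
  open import Data.Nat.Properties hiding (_≟_)

  sumOver : {A : Set} → List A → (A → ℕ) → ℕ
  sumOver xs F = List.sum (map F xs)

  module _ {A : Set} where

    sumOver-cong : (xs : List A) {F H : A → ℕ} → (∀ x → F x ≡ H x) → sumOver xs F ≡ sumOver xs H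
    sumOver-cong []       F≗H = refl
    sumOver-cong (x ∷ xs) F≗H = cong₂ _+_ (F≗H x) (sumOver-cong xs F≗H)

    sumOver-mono : (xs : List A) {F H : A → ℕ} → (∀ x → F x ≤ H x) → sumOver xs F ≤ sumOver xs H
    sumOver-mono []       F≤H = z≤n
    sumOver-mono (x ∷ xs) F≤H = +-mono-≤ (F≤H x) (sumOver-mono xs F≤H)

    sumOver-+ : (xs : List A) (F H : A → ℕ) → sumOver xs (λ x → F x + H x) ≡ sumOver xs F + sumOver xs H
    sumOver-+ []       F H = refl
    sumOver-+ (x ∷ xs) F H rewrite sumOver-+ xs F H = interchange (F x) (H x) _ _
      where open import Algebra.Properties.CommutativeSemigroup +-commutativeSemigroup

    sumOver-* : (xs : List A) (c : ℕ) (F : A → ℕ) → sumOver xs (λ x → c * F x) ≡ c * sumOver xs F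
    sumOver-* []       c F = sym (*-zeroʳ c)
    sumOver-* (x ∷ xs) c F rewrite sumOver-* xs c F = sym (*-distribˡ-+ c (F x) _)

    sumOver-const : (xs : List A) (c : ℕ) → sumOver xs (λ _ → c) ≡ c * length xs
    sumOver-const []       c = sym (*-zeroʳ c)
    sumOver-const (x ∷ xs) c rewrite sumOver-const xs c = sym (*-suc c (length xs))

    sumOver-sum : ∀ {n} (xs : List A) (F : Fin n → A → ℕ) →
                  sumOver xs (λ x → sum (λ i → F i x)) ≡ sum (λ i → sumOver xs (F i))
    sumOver-sum {zero}  xs F = trans (sumOver-const xs 0) refl
    sumOver-sum {suc n} xs F =
      trans (sumOver-+ xs (F zero) _) (cong (sumOver xs (F zero) +_) (sumOver-sum xs (F ∘ suc)))

    sumOver-concatMap : ∀ {B : Set} (g : B → List A) (F : A → ℕ) (ys : List B) →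
                        sumOver (concatMap g ys) F ≡ sumOver ys (λ y → sumOver (g y) F)
    sumOver-concatMap g F []       = refl
    sumOver-concatMap g F (y ∷ ys)
      rewrite map-++ F (g y) (concatMap g ys) | sum-++ (map F (g y)) (map F (concatMap g ys)) =
      cong (sumOver (g y) F +_) (sumOver-concatMap g F ys)

    sumOver-filterᵇ : (p : A → Bool) (xs : List A) (F : A → ℕ) →
                      sumOver (filterᵇ p xs) F ≡ sumOver xs (λ x → ⟦ p x ⟧ * F x)
    sumOver-filterᵇ p []       F = refl
    sumOver-filterᵇ p (x ∷ xs) F with p x
    ... | true  rewrite +-identityʳ (F x) = cong (F x +_) (sumOver-filterᵇ p xs F)
    ... | false = sumOver-filterᵇ p xs F

    sumOver-tabulate : ∀ {n} (g : Fin n → A) (F : A → ℕ) → sumOver (tabulate g) F ≡ sum (F ∘ g)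
    sumOver-tabulate {zero}  g F = refl
    sumOver-tabulate {suc n} g F = cong (F (g zero) +_) (sumOver-tabulate (g ∘ suc) F)

  -- Rearranged functions agree with the listed ones only pointwise, so the functionals summed over
  -- them have to respect pointwise equality.
  Extensional : {A B C : Set} → ((A → B) → C) → Set
  Extensional F = ∀ {f g} → f ≗ g → F f ≡ F g

  sum-∷-extensional : ∀ {k j} {F : (Fin (suc k) → Fin j) → ℕ} → Extensional F →
                      Extensional {Fin k} {Fin j} (λ f → sum (λ x → F (x Vector.∷ f)))
  sum-∷-extensional {j = j} ext {f} {g} f≗g =
    sum-cong-≗ {j} λ x → ext {x Vector.∷ f} {x Vector.∷ g} λ { zero → refl ; (suc i) → f≗g i }

  sumOver-allFuns-suc : ∀ k j {F : (Fin (suc k) → Fin j) → ℕ} → Extensional F →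
    sumOver (allFuns (suc k) j) F ≡ sumOver (allFuns k j) (λ f → sum (λ x → F (x Vector.∷ f)))
  sumOver-allFuns-suc k j {F} ext = trans
    (sumOver-concatMap (λ f → map _ (allFin j)) F (allFuns k j))
    (sumOver-cong (allFuns k j) λ f → extensions f _ λ { x zero → refl ; x (suc i) → refl })
    where
    -- `h` stands for the anonymous pattern-matching function inside `allFuns`, recovered by
    -- unification; it is compared with `x Vector.∷ f` only pointwise.
    extensions : ∀ f (h : Fin j → Fin (suc k) → Fin j) → (∀ x → h x ≗ (x Vector.∷ f)) →
                 sumOver (map h (allFin j)) F ≡ sum (λ x → F (x Vector.∷ f))
    extensions f h h≗ = trans (cong (λ hs → sumOver hs F) (map-tabulate id h))
      (trans (sumOver-tabulate h F) (sum-cong-≗ (ext ∘ h≗)))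

  module Invariance (j : ℕ) where

    -- Transpositions are generated from `(0 1)` by lifting and composition, so invariance reduces
    -- to exchanging two sums and the list `allFuns k j` is never permuted explicitly.
    Invariant : ∀ {k} → (Fin k → Fin k) → Set
    Invariant {k} τ = ∀ {F : (Fin k → Fin j) → ℕ} → Extensional F →
      sumOver (allFuns k j) (λ f → F (f ∘ τ)) ≡ sumOver (allFuns k j) F

    invariant-id : ∀ {k} → Invariant {k} id
    invariant-id ext = refl

    invariant-cong : ∀ {k} {τ σ : Fin k → Fin k} → τ ≗ σ → Invariant τ → Invariant σ
    invariant-cong {k} τ≗σ inv ext =
      trans (sumOver-cong (allFuns k j) λ f → ext λ i → cong f (sym (τ≗σ i))) (inv ext)

    invariant-∘ : ∀ {k} {τ σ : Fin k → Fin k} → Invariant τ → Invariant σ → Invariant (τ ∘ σ)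
    invariant-∘ {σ = σ} invτ invσ ext = trans (invτ (λ f≗g → ext (f≗g ∘ σ))) (invσ ext)

    invariant-lift : ∀ {k} {τ : Fin k → Fin k} → Invariant τ → Invariant (lift 1 τ)
    invariant-lift {k} {τ} inv {F} ext = begin
      sumOver (allFuns (suc k) j) (λ f → F (f ∘ lift 1 τ))
        ≡⟨ sumOver-allFuns-suc k j (λ f≗g → ext (f≗g ∘ lift 1 τ)) ⟩
      sumOver (allFuns k j) (λ f → sum (λ x → F ((x Vector.∷ f) ∘ lift 1 τ)))
        ≡⟨ sumOver-cong (allFuns k j) (λ f → sum-cong-≗ λ x →
             ext {(x Vector.∷ f) ∘ lift 1 τ} {x Vector.∷ (f ∘ τ)} λ { zero → refl ; (suc i) → refl }) ⟩
      sumOver (allFuns k j) (λ f → sum (λ x → F (x Vector.∷ (f ∘ τ))))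
        ≡⟨ inv (sum-∷-extensional ext) ⟩
      sumOver (allFuns k j) (λ f → sum (λ x → F (x Vector.∷ f)))
        ≡⟨ sumOver-allFuns-suc k j ext ⟨
      sumOver (allFuns (suc k) j) F ∎
      where open ≡-Reasoning

    sumOver-allFuns-2+ : ∀ k {F : (Fin (suc (suc k)) → Fin j) → ℕ} → Extensional F →
      sumOver (allFuns (suc (suc k)) j) F ≡
      sumOver (allFuns k j) (λ f → sum (λ y → sum (λ x → F (x Vector.∷ y Vector.∷ f))))
    sumOver-allFuns-2+ k ext = trans (sumOver-allFuns-suc (suc k) j ext)
      (sumOver-allFuns-suc k j (sum-∷-extensional ext))

    -- Swapping the first two arguments of a function exchanges the two inner sums, which range over
    -- its first two values.
    invariant-transpose₀₁ : ∀ {k} → Invariant (transpose {suc (suc k)} zero (suc zero))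
    invariant-transpose₀₁ {k} {F} ext = begin
      sumOver (allFuns (suc (suc k)) j) (λ f → F (f ∘ τ))
        ≡⟨ sumOver-allFuns-2+ k (λ f≗g → ext (f≗g ∘ τ)) ⟩
      sumOver (allFuns k j) (λ f → sum (λ y → sum (λ x → F ((x Vector.∷ y Vector.∷ f) ∘ τ))))
        ≡⟨ sumOver-cong (allFuns k j) (λ f → sum-cong-≗ λ y → sum-cong-≗ λ x → ext {(x Vector.∷ y Vector.∷ f) ∘ τ} {y Vector.∷ x Vector.∷ f} λ where
             zero          → refl
             (suc zero)    → refl
             (suc (suc i)) → refl) ⟩
      sumOver (allFuns k j) (λ f → sum (λ y → sum (λ x → F (y Vector.∷ x Vector.∷ f))))
        ≡⟨ sumOver-cong (allFuns k j) (λ f → ∑-comm (λ y x → F (y Vector.∷ x Vector.∷ f))) ⟩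
      sumOver (allFuns k j) (λ f → sum (λ x → sum (λ y → F (y Vector.∷ x Vector.∷ f))))
        ≡⟨ sumOver-allFuns-2+ k ext ⟨
      sumOver (allFuns (suc (suc k)) j) F ∎
      where
      open ≡-Reasoning
      τ = transpose zero (suc zero)

    invariant-transpose₀ : ∀ {k} (b : Fin (suc k)) → Invariant (transpose zero b)
    invariant-transpose₀ zero = invariant-cong (λ { zero → refl ; (suc i) → refl }) invariant-id
    invariant-transpose₀ (suc zero) = invariant-transpose₀₁
    -- (0 b+1) = (0 1) (1 b+1) (0 1)
    invariant-transpose₀ (suc (suc b)) = invariant-cong agree
      (invariant-∘ invariant-transpose₀₁
        (invariant-∘ (invariant-lift (invariant-transpose₀ (suc b))) invariant-transpose₀₁))
      where
      agree : transpose zero (suc zero) ∘ lift 1 (transpose zero (suc b)) ∘ transpose zero (suc zero)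
              ≗ transpose zero (suc (suc b))
      agree zero          = refl
      agree (suc zero)    = refl
      agree (suc (suc i)) with does (i ≟ b)
      ... | true  = refl
      ... | false = refl

    invariant-transpose : ∀ {k} (a b : Fin k) → Invariant (transpose a b)
    invariant-transpose zero b = invariant-transpose₀ b
    invariant-transpose (suc a) zero = invariant-cong agree (invariant-transpose₀ (suc a))
      where
      agree : transpose zero (suc a) ≗ transpose (suc a) zero
      agree zero    = refl
      agree (suc i) with does (i ≟ a)
      ... | true  = refl
      ... | false = refl
    invariant-transpose (suc a) (suc b) = invariant-cong agree (invariant-lift (invariant-transpose a b))
      where
      agree : lift 1 (transpose a b) ≗ transpose (suc a) (suc b)
      agree zero    = refl
      agree (suc i) = sym (Perm.lift₀-transpose a b (suc i))

  and-map⁻ : {A : Set} (p : A → Bool) (xs : List A) → and (map p xs) ≡ true → ∀ {x} → x ∈ xs → p x ≡ true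
  and-map⁻ p (x ∷ xs) eq with p x in px
  and-map⁻ p (x ∷ xs) eq | true = λ { (here refl) → px ; (there x∈xs) → and-map⁻ p xs eq x∈xs }

  and-map⁺ : {A : Set} (p : A → Bool) (xs : List A) → (∀ x → p x ≡ true) → and (map p xs) ≡ true
  and-map⁺ p []       ∀p = refl
  and-map⁺ p (x ∷ xs) ∀p rewrite ∀p x = and-map⁺ p xs ∀p

  module _ {k : ℕ} where

    private
      distinct : (Fin k → Fin k) → Fin k → Fin k → Bool
      distinct f a b = ⌊ a ≟ b ⌋ ∨ not ⌊ f a ≟ f b ⌋

    isInjective⇒injective : (f : Fin k → Fin k) → isInjective f ≡ true → Injective _≡_ _≡_ f
    isInjective⇒injective f inj {a} {b} fa≡fb
      with a ≟ b | f a ≟ f b | and-map⁻ (distinct f a) _ (and-map⁻ _ _ inj (∈-allFin a)) (∈-allFin b)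
    ... | yes a≡b | _         | _  = a≡b
    ... | no  _   | yes _     | ()
    ... | no  _   | no  fa≢fb | _  = contradiction fa≡fb fa≢fb

    injective⇒isInjective : (f : Fin k → Fin k) → Injective _≡_ _≡_ f → isInjective f ≡ true
    injective⇒isInjective f inj = and-map⁺ _ (allFin k) λ a → and-map⁺ (distinct f a) (allFin k) λ b → holds a b
      where
      holds : ∀ a b → distinct f a b ≡ true
      holds a b with a ≟ b | f a ≟ f b
      ... | yes _   | _         = refl
      ... | no  a≢b | yes fa≡fb = contradiction (inj fa≡fb) a≢b
      ... | no  _   | no  _     = refl

    isInjective-cong : ∀ {f g : Fin k → Fin k} → (Injective _≡_ _≡_ f → Injective _≡_ _≡_ g) →
                       (Injective _≡_ _≡_ g → Injective _≡_ _≡_ f) → isInjective f ≡ isInjective g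
    isInjective-cong {f} {g} f⇒g g⇒f = ⇔→≡ {z = true} (mk⇔
      (injective⇒isInjective g ∘ f⇒g ∘ isInjective⇒injective f)
      (injective⇒isInjective f ∘ g⇒f ∘ isInjective⇒injective g))

    isInjective-ext : Extensional (isInjective {k})
    isInjective-ext f≗g = isInjective-cong
      (λ inj gx≡gy → inj (trans (f≗g _) (trans gx≡gy (sym (f≗g _)))))
      (λ inj fx≡fy → inj (trans (sym (f≗g _)) (trans fx≡fy (f≗g _))))

    transpose-injective : (a b : Fin k) → Injective _≡_ _≡_ (transpose a b)
    transpose-injective a b τx≡τy =
      trans (sym (transpose-inverse b a)) (trans (cong (transpose b a) τx≡τy) (transpose-inverse b a))

    isInjective-transpose : (a b : Fin k) (f : Fin k → Fin k) → isInjective (f ∘ transpose a b) ≡ isInjective f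
    isInjective-transpose a b f = isInjective-cong
      (λ inj fx≡fy → transpose-injective b a (inj
         (trans (cong f (transpose-inverse a b)) (trans fx≡fy (cong f (sym (transpose-inverse a b)))))))
      (λ inj fτx≡fτy → transpose-injective a b (inj fτx≡fτy))

  total : (k : ℕ) → ((Fin k → Fin k) → ℕ) → ℕ
  total k = sumOver (rankOrders k)

  -- The filter becomes a 0-1 weight, and the hypothesis is applied where the weight is 1.
  -- Injectivity is passed on so that `F≤H` may assume distinct ranks.
  total-mono : ∀ k {F H : (Fin k → Fin k) → ℕ} → (∀ ρ → Injective _≡_ _≡_ ρ → F ρ ≤ H ρ) → total k F ≤ total k H
  total-mono k {F} {H} F≤H = begin
    total k F                                             ≡⟨ sumOver-filterᵇ isInjective (allFuns k k) F ⟩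
    sumOver (allFuns k k) (λ f → ⟦ isInjective f ⟧ * F f) ≤⟨ sumOver-mono (allFuns k k) weighted ⟩
    sumOver (allFuns k k) (λ f → ⟦ isInjective f ⟧ * H f) ≡⟨ sumOver-filterᵇ isInjective (allFuns k k) H ⟨
    total k H                                             ∎
    where
    open ≤-Reasoning
    weighted : ∀ f → ⟦ isInjective f ⟧ * F f ≤ ⟦ isInjective f ⟧ * H f
    weighted f with isInjective f in inj
    ... | true  = *-monoʳ-≤ 1 (F≤H f (isInjective⇒injective f inj))
    ... | false = z≤n

  -- The uniform distribution on rank orders is invariant under swapping two ranks: the weight
  -- `isInjective` is itself invariant, so invariance of the sum over all functions carries over.
  total-transpose : ∀ {k} (a b : Fin k) {F : (Fin k → Fin k) → ℕ} → Extensional F →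
                    total k (λ ρ → F (ρ ∘ transpose a b)) ≡ total k F
  total-transpose {k} a b {F} ext = begin
    total k (λ ρ → F (ρ ∘ τ))
      ≡⟨ sumOver-filterᵇ isInjective (allFuns k k) _ ⟩
    sumOver (allFuns k k) (λ f → ⟦ isInjective f ⟧ * F (f ∘ τ))
      ≡⟨ sumOver-cong (allFuns k k) (λ f → cong (λ b → ⟦ b ⟧ * F (f ∘ τ)) (isInjective-transpose a b f)) ⟨
    sumOver (allFuns k k) (λ f → ⟦ isInjective (f ∘ τ) ⟧ * F (f ∘ τ))
      ≡⟨ Invariance.invariant-transpose k a b
           (λ f≗g → cong₂ (λ b x → ⟦ b ⟧ * x) (isInjective-ext f≗g) (ext f≗g)) ⟩
    sumOver (allFuns k k) (λ f → ⟦ isInjective f ⟧ * F f)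
      ≡⟨ sumOver-filterᵇ isInjective (allFuns k k) F ⟨
    total k F ∎
    where
    open ≡-Reasoning
    τ = transpose a b

-- Ranking as a sequence of single steps.

module Simulation where

  open Counting
  open import Data.Nat using (_≤_; _<?_)
  open import Data.Nat.Properties hiding (_≟_)

  -- The local functions of pickMin and rankingALG are named by letting
  -- unification recover them from the unfolded definitions.
  mutual
    scan : ∀ {k} → (Fin k → Fin k) → (Fin k → Bool) → List (Fin k) → Maybe (Fin k)
    scan = _

    pickMin≡scan : ∀ {k} (ρ : Fin k → Fin k) (cand : Fin k → Bool) → pickMin ρ cand ≡ scan ρ cand (allFin k)
    pickMin≡scan {k} ρ cand with allFin k
    ... | ss = refl

  mutual
    run : (G : Instance) → (Fin (n G) → Fin (n G)) → (Fin (n G) → Bool) → List (Fin (m G)) → ℕ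
    run = _

    rankingALG≡run : ∀ G ρ → rankingALG G ρ ≡ run G ρ (λ _ → false) (allFin (m G))
    rankingALG≡run G ρ with allFin (m G) | (λ (_ : Fin (n G)) → false)
    ... | rs | M = refl

  data Picked {k} (ρ : Fin k → Fin k) (cand : Fin k → Bool) (ss : List (Fin k)) : Maybe (Fin k) → Set where
    none  : (∀ {t} → t ∈ ss → cand t ≡ false) → Picked ρ cand ss nothing
    least : ∀ {s} → cand s ≡ true → (∀ {t} → t ∈ ss → cand t ≡ true → toℕ (ρ s) ≤ toℕ (ρ t)) →
            Picked ρ cand ss (just s)

  scan-picked : ∀ {k} (ρ : Fin k → Fin k) (cand : Fin k → Bool) ss → Picked ρ cand ss (scan ρ cand ss)
  scan-picked ρ cand []       = none λ ()
  scan-picked ρ cand (s ∷ ss) with scan ρ cand ss | scan-picked ρ cand ss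
  ... | nothing | none ∄ with cand s in cs
  ...   | true  = least cs λ where
          (here refl) _  → ≤-refl
          (there t∈)  ct → contradiction (trans (sym ct) (∄ t∈)) λ ()
  ...   | false = none λ { (here refl) → cs ; (there t∈) → ∄ t∈ }
  scan-picked ρ cand (s ∷ ss) | just b | least cb b≤ with cand s in cs | toℕ (ρ s) <? toℕ (ρ b)
  ... | false | _       = least cb λ where
          (here refl) ct → contradiction (trans (sym ct) cs) λ ()
          (there t∈)  ct → b≤ t∈ ct
  ... | true  | yes s<b rewrite <ᵇ-true s<b = least cs λ where
          (here refl) _  → ≤-refl
          (there t∈)  ct → ≤-trans (<⇒≤ s<b) (b≤ t∈ ct)
  ... | true  | no  s≮b rewrite <ᵇ-false (≮⇒≥ s≮b) = least cb λ where
          (here refl) _  → ≮⇒≥ s≮b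
          (there t∈)  ct → b≤ t∈ ct

  insert : ∀ {k} → Fin k → (Fin k → Bool) → Fin k → Bool
  insert s M t = ⌊ t ≟ s ⌋ ∨ M t

  insert-here : ∀ {k} (s : Fin k) M → insert s M s ≡ true
  insert-here s M rewrite ⌊⌋-true (s ≟ s) refl = refl

  insert-there : ∀ {k} {s t : Fin k} M → t ≢ s → insert s M t ≡ M t
  insert-there {s = s} {t} M t≢s rewrite ⌊⌋-false (t ≟ s) t≢s = refl

  -- `unmatched` carries no evidence: the aim is an upper bound on the matching, to which an
  -- unmatched request adds nothing.
  data Step (G : Instance) (ρ : Fin (n G) → Fin (n G)) (M : Fin (n G) → Bool)
            (r : Fin (m G)) (rs : List (Fin (m G))) : ℕ → Set where
    unmatched : Step G ρ M r rs (run G ρ M rs)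
    matched   : ∀ s → adj G r s ≡ true → M s ≡ false →
                (∀ t → adj G r t ≡ true → M t ≡ false → toℕ (ρ s) ≤ toℕ (ρ t)) →
                Step G ρ M r rs (suc (run G ρ (insert s M) rs))

  run-step : ∀ G ρ M r rs → Step G ρ M r rs (run G ρ M (r ∷ rs))
  run-step G ρ M r rs
    with pickMin ρ cand | subst (Picked ρ cand (allFin (n G))) (sym (pickMin≡scan ρ cand)) (scan-picked ρ cand (allFin (n G)))
    where
    cand : Fin (n G) → Bool
    cand s = adj G r s ∧ not (M s)
  ... | nothing | _ = unmatched
  ... | just s  | least cs s≤ with adj G r s in as | M s in Ms
  ...   | true | false = matched s as Ms λ t at Mt → s≤ (∈-allFin t) (cong₂ (λ a b → a ∧ not b) at Mt)

-- The hard instance: regularity, a perfect matching, and the analysis of a run.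

module HardInstance (k : ℕ) where

  open Counting
  open ServedCount
  open Simulation
  open import Data.Nat using (_+_; _≤_; _<_; z≤n; s≤s; _<ᵇ_)
  open import Data.Nat.Properties hiding (_≟_)

  Server Request : Set
  Server  = Fin (k + suc k)
  Request = Fin (suc k + k)

  B : Fin k → Server
  B j = j ↑ˡ suc k

  A : Fin (suc k) → Server
  A i = k ↑ʳ i

  early : Fin (suc k) → Request
  early i = i ↑ˡ k

  late : Fin k → Request
  late j = suc k ↑ʳ j

  edge : Fin (suc k) ⊎ Fin k → Fin k ⊎ Fin (suc k) → Bool
  edge (inj₁ i) (inj₁ j) = true
  edge (inj₁ i) (inj₂ l) = ⌊ i ≟ l ⌋
  edge (inj₂ i) (inj₁ j) = false
  edge (inj₂ i) (inj₂ l) = true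

  G : Instance
  G = record { n = k + suc k ; m = suc k + k ; adj = λ r s → edge (splitAt (suc k) r) (splitAt k s) }

  data ServerView : Server → Set where
    isB : ∀ j → ServerView (B j)
    isA : ∀ i → ServerView (A i)

  serverView : ∀ s → ServerView s
  serverView s with splitAt k s in eq
  ... | inj₁ j = subst ServerView (splitAt⁻¹-↑ˡ eq) (isB j)
  ... | inj₂ i = subst ServerView (splitAt⁻¹-↑ʳ {k} eq) (isA i)

  data RequestView : Request → Set where
    isEarly : ∀ i → RequestView (early i)
    isLate  : ∀ j → RequestView (late j)

  requestView : ∀ r → RequestView r
  requestView r with splitAt (suc k) r in eq
  ... | inj₁ i = subst RequestView (splitAt⁻¹-↑ˡ eq) (isEarly i)
  ... | inj₂ j = subst RequestView (splitAt⁻¹-↑ʳ {suc k} eq) (isLate j)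

  adj-early-B : ∀ i j → adj G (early i) (B j) ≡ true
  adj-early-B i j rewrite splitAt-↑ˡ (suc k) i k | splitAt-↑ˡ k j (suc k) = refl

  adj-early-A : ∀ i l → adj G (early i) (A l) ≡ ⌊ i ≟ l ⌋
  adj-early-A i l rewrite splitAt-↑ˡ (suc k) i k | splitAt-↑ʳ k (suc k) l = refl

  adj-late-B : ∀ i j → adj G (late i) (B j) ≡ false
  adj-late-B i j rewrite splitAt-↑ʳ (suc k) k i | splitAt-↑ˡ k j (suc k) = refl

  adj-late-A : ∀ i l → adj G (late i) (A l) ≡ true
  adj-late-A i l rewrite splitAt-↑ʳ (suc k) k i | splitAt-↑ʳ k (suc k) l = refl

  A≢B : ∀ {i j} → A i ≢ B j
  A≢B {i} {j} eq with trans (sym (splitAt-↑ʳ k (suc k) i)) (trans (cong (splitAt k) eq) (splitAt-↑ˡ k j (suc k)))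
  ... | ()

  A-injective : ∀ {i l} → A i ≡ A l → i ≡ l
  A-injective = ↑ʳ-injective k _ _

  B-injective : ∀ {i l} → B i ≡ B l → i ≡ l
  B-injective = ↑ˡ-injective (suc k) _ _

  #-servers : (p : Server → Bool) → # p ≡ # (p ∘ B) + # (p ∘ A)
  #-servers p = sum-split k (⟦_⟧ ∘ p)

  #-requests : (p : Request → Bool) → # p ≡ # (p ∘ early) + # (p ∘ late)
  #-requests p = sum-split (suc k) (⟦_⟧ ∘ p)

  #-≟ˡ : ∀ {n} (i : Fin n) → # (λ l → ⌊ i ≟ l ⌋) ≡ 1
  #-≟ˡ i = #-singleton i (⌊⌋-true (i ≟ i) refl) λ t t≢i → ⌊⌋-false (i ≟ t) (t≢i ∘ sym)

  #-≟ʳ : ∀ {n} (i : Fin n) → # (λ l → ⌊ l ≟ i ⌋) ≡ 1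
  #-≟ʳ i = #-singleton i (⌊⌋-true (i ≟ i) refl) λ t t≢i → ⌊⌋-false (t ≟ i) t≢i

  regular : IsRegular (suc k) G
  regular = (λ r → trans (countTrue-allFin (adj G r)) (request (requestView r)))
          , (λ s → trans (countTrue-allFin (λ r → adj G r s)) (server (serverView s)))
    where
    request : ∀ {r} → RequestView r → # (adj G r) ≡ suc k
    request (isEarly i) = trans (#-servers (adj G (early i))) (trans
      (cong₂ _+_ (trans (#-cong (adj-early-B i)) (#-true k)) (trans (#-cong (adj-early-A i)) (#-≟ˡ i)))
      (+-comm k 1))
    request (isLate j) = trans (#-servers (adj G (late j)))
      (cong₂ _+_ (trans (#-cong (adj-late-B j)) (#-false k)) (trans (#-cong (adj-late-A j)) (#-true (suc k))))
    server : ∀ {s} → ServerView s → # (λ r → adj G r s) ≡ suc k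
    server (isB j) = trans (#-requests (λ r → adj G r (B j))) (trans
      (cong₂ _+_ (trans (#-cong (λ i → adj-early-B i j)) (#-true (suc k)))
                 (trans (#-cong (λ i → adj-late-B i j)) (#-false k)))
      (+-identityʳ (suc k)))
    server (isA i) = trans (#-requests (λ r → adj G r (A i)))
      (cong₂ _+_ (trans (#-cong (λ l → adj-early-A l i)) (#-≟ʳ i))
                 (trans (#-cong (λ j → adj-late-A j i)) (#-true k)))

  optimum : IsOPT G (suc k + k)
  optimum = (M , (M⊆E , M-injective) , M-size)
          , λ M′ _ → subst (_≤ suc k + k) (sym (countTrue-allFin (λ r → is-just (M′ r)))) (#≤n (λ r → is-just (M′ r)))
    where
    -- There is one early request more than there are B's. Request 0 takes its own A, which leaves
    -- exactly k A's for the k late requests, so the matching is perfect.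
    partner : Fin (suc k) ⊎ Fin k → Server
    partner (inj₁ zero)    = A zero
    partner (inj₁ (suc i)) = B i
    partner (inj₂ j)       = A (suc j)

    M : Request → Maybe Server
    M r = just (partner (splitAt (suc k) r))

    M⊆E : ∀ r s → M r ≡ just s → adj G r s ≡ true
    M⊆E r s refl with splitAt (suc k) r
    ... | inj₁ zero    rewrite splitAt-↑ʳ k (suc k) zero    = refl
    ... | inj₁ (suc i) rewrite splitAt-↑ˡ k i (suc k)       = refl
    ... | inj₂ j       rewrite splitAt-↑ʳ k (suc k) (suc j) = refl

    partner-injective : ∀ x y → partner x ≡ partner y → x ≡ y
    partner-injective (inj₁ zero)    (inj₁ zero)    eq = refl
    partner-injective (inj₁ zero)    (inj₁ (suc i)) eq = contradiction eq A≢B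
    partner-injective (inj₁ zero)    (inj₂ j)       eq with () ← A-injective eq
    partner-injective (inj₁ (suc i)) (inj₁ zero)    eq = contradiction (sym eq) A≢B
    partner-injective (inj₁ (suc i)) (inj₁ (suc l)) eq = cong (inj₁ ∘ suc) (B-injective eq)
    partner-injective (inj₁ (suc i)) (inj₂ j)       eq = contradiction (sym eq) A≢B
    partner-injective (inj₂ j)       (inj₁ zero)    eq with () ← A-injective eq
    partner-injective (inj₂ j)       (inj₁ (suc i)) eq = contradiction eq A≢B
    partner-injective (inj₂ j)       (inj₂ l)       eq with refl ← A-injective eq = refl

    splitAt-injective : ∀ {r r′ : Request} → splitAt (suc k) r ≡ splitAt (suc k) r′ → r ≡ r′
    splitAt-injective {r} {r′} eq with splitAt (suc k) r in e | splitAt (suc k) r′ in e′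
    splitAt-injective refl | inj₁ i | _ = trans (sym (splitAt⁻¹-↑ˡ e)) (splitAt⁻¹-↑ˡ e′)
    splitAt-injective refl | inj₂ j | _ = trans (sym (splitAt⁻¹-↑ʳ {suc k} e)) (splitAt⁻¹-↑ʳ {suc k} e′)

    M-injective : ∀ r r′ s → M r ≡ just s → M r′ ≡ just s → r ≡ r′
    M-injective r r′ s refl eq = splitAt-injective (partner-injective _ _ (just-injective (sym eq)))

    M-size : matchingSize G M ≡ suc k + k
    M-size = trans (countTrue-allFin (λ r → is-just (M r))) (#-true (suc k + k))

  -- Ranking on the hard instance for fixed ranks.

  module _ (ρ : Server → Server) where

    rank : Server → ℕ
    rank s = toℕ (ρ s)

    arrivals : List (Fin (suc k)) → List ℕ
    arrivals = map (rank ∘ A)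

    J : List (Fin (suc k)) → ℕ
    J us = served (map (below (rank ∘ B)) (arrivals us))

    module _ (ρ-injective : Injective _≡_ _≡_ ρ) where

      rank-< : ∀ {s t} → s ≢ t → rank s ≤ rank t → rank s < rank t
      rank-< s≢t s≤t = ≤∧≢⇒< s≤t (s≢t ∘ ρ-injective ∘ toℕ-injective)

      #-insert-A : ∀ M s → M s ≡ false → ∀ {i} → s ≡ A i →
                   # (not ∘ M ∘ A) ≡ suc (# (not ∘ insert s M ∘ A))
      #-insert-A M s Ms {i} refl = #-insert i (cong not (insert-here s M)) (cong not Ms)
        λ t t≢i → cong not (sym (insert-there M (t≢i ∘ A-injective)))

      -- A late request can only be matched to an A, and each such match uses up a free one.
      run-late : ∀ M qs → run G ρ M (map late qs) ≤ # (not ∘ M ∘ A)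
      run-late M []       = z≤n
      run-late M (q ∷ qs) with run G ρ M (map late (q ∷ qs)) | run-step G ρ M (late q) (map late qs)
      ... | _ | unmatched = run-late M qs
      ... | _ | matched s as Ms _ with serverView s
      ...   | isB j = contradiction (trans (sym as) (adj-late-B q j)) λ ()
      ...   | isA i rewrite #-insert-A M s Ms refl = s≤s (run-late (insert s M) qs)

      -- `done` lists the requests already treated, latest first.
      record Early (M : Server → Bool) (done todo : List (Fin (suc k))) : Set where
        field
          few     : # (M ∘ B) ≤ J done
          initial : ∀ b b′ → M (B b) ≡ true → M (B b′) ≡ false → rank (B b) < rank (B b′)
          fresh   : All (λ i → M (A i) ≡ false) todo

      open Early

      -- Covers both an unmatched request and one matched to its own A: the set of matched B's stays
      -- the same, while `J` does not decrease.
      skip-B : ∀ {M M′ u us todo} → M ∘ B ≗ M′ ∘ B → All (λ i → M′ (A i) ≡ false) todo →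
               Early M us (u ∷ todo) → Early M′ (u ∷ us) todo
      skip-B {u = u} {us} M≗M′ fresh′ e .few =
        ≤-trans (≤-reflexive (sym (#-cong M≗M′))) (≤-trans (few e) (j≤step (below (rank ∘ B) (rank (A u))) (J us)))
      skip-B M≗M′ fresh′ e .initial b b′ Mb Mb′ = initial e b b′ (trans (M≗M′ b) Mb) (trans (M≗M′ b′) Mb′)
      skip-B M≗M′ fresh′ e .fresh = fresh′

      -- `A u` is still free by `fresh`, so the preferred `b` has smaller rank. By `initial` the B's
      -- matched earlier rank below `b`. Hence all matched B's, `b` included, are counted by the new
      -- threshold; their number is also at most `suc (J us)`, and `≤step` combines the two bounds.
      match-B : ∀ {M u us todo} b → M (B b) ≡ false →
                (∀ t → adj G (early u) t ≡ true → M t ≡ false → rank (B b) ≤ rank t) →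
                Early M us (u ∷ todo) → Early (insert (B b) M) (u ∷ us) todo
      match-B {M} {u} {us} {todo} b Mb b≤ e = record { few = few′ ; initial = initial′ ; fresh = fresh′ }
        where
        M′ : Server → Bool
        M′ = insert (B b) M

        Mu : M (A u) ≡ false
        Mu = All.head (fresh e)

        b<u : rank (B b) < rank (A u)
        b<u = rank-< (A≢B ∘ sym) (b≤ (A u) (trans (adj-early-A u u) (⌊⌋-true (u ≟ u) refl)) Mu)

        M′⇒below : ∀ b′ → M′ (B b′) ≡ true → (rank (B b′) <ᵇ rank (A u)) ≡ true
        M′⇒below b′ eq with b′ ≟ b
        ... | yes refl = <ᵇ-true b<u
        ... | no  b′≢b = <ᵇ-true (<-trans
          (initial e b′ b (trans (sym (insert-there M (b′≢b ∘ B-injective))) eq) Mb) b<u)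

        few′ : # (M′ ∘ B) ≤ J (u ∷ us)
        few′ = ≤step (#-mono {p = M′ ∘ B} M′⇒below) (≤-trans
          (≤-reflexive (#-insert b Mb (insert-here (B b) M) λ t t≢b → insert-there M (t≢b ∘ B-injective)))
          (s≤s (few e)))

        initial′ : ∀ b₁ b₂ → M′ (B b₁) ≡ true → M′ (B b₂) ≡ false → rank (B b₁) < rank (B b₂)
        initial′ b₁ b₂ M′b₁ M′b₂ with b₂ ≟ b
        ... | yes refl = contradiction (trans (sym (insert-here (B b) M)) M′b₂) λ ()
        ... | no  b₂≢b with b₁ ≟ b
        ...   | yes refl = rank-< (b₂≢b ∘ sym ∘ B-injective)
                  (b≤ (B b₂) (adj-early-B u b₂) (trans (sym (insert-there M (b₂≢b ∘ B-injective))) M′b₂))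
        ...   | no  b₁≢b = initial e b₁ b₂
                  (trans (sym (insert-there M (b₁≢b ∘ B-injective))) M′b₁)
                  (trans (sym (insert-there M (b₂≢b ∘ B-injective))) M′b₂)

        fresh′ : All (λ i → M′ (A i) ≡ false) todo
        fresh′ = All.map (trans (insert-there M A≢B)) (All.tail (fresh e))

      -- Each match adds one to the run and removes one free server, so the inequality propagates
      -- back through the early requests. After them, the late ones gain at most the free A's, and k
      -- splits into the free B's and the matched B's, the latter bounded by `few`.
      run-early : ∀ todo {M done} qs → Unique todo → Early M done todo →
                  run G ρ M (map early todo ++ map late qs) + k ≤ # (not ∘ M) + J (todo ʳ++ done)
      run-early [] {M} {done} qs _ e = begin
        run G ρ M (map late qs) + k                                 ≤⟨ +-monoˡ-≤ k (run-late M qs) ⟩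
        # (not ∘ M ∘ A) + k                                         ≡⟨ cong (# (not ∘ M ∘ A) +_) (#-complement (M ∘ B)) ⟨
        # (not ∘ M ∘ A) + (# (M ∘ B) + # (not ∘ M ∘ B))             ≡⟨ solve 3 (λ x y z → x :+ (y :+ z) := (z :+ x) :+ y) refl
                                                                         (# (not ∘ M ∘ A)) (# (M ∘ B)) (# (not ∘ M ∘ B)) ⟩
        # (not ∘ M ∘ B) + # (not ∘ M ∘ A) + # (M ∘ B)               ≤⟨ +-monoʳ-≤ (# (not ∘ M ∘ B) + # (not ∘ M ∘ A)) (few e) ⟩
        # (not ∘ M ∘ B) + # (not ∘ M ∘ A) + J done                  ≡⟨ cong (_+ J done) (#-servers (not ∘ M)) ⟨
        # (not ∘ M) + J done                                        ∎
        where
        open ≤-Reasoning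
        open import Data.Nat.Solver using (module +-*-Solver)
        open +-*-Solver
      run-early (u ∷ todo) {M} qs (u∉todo ∷ unique) e
        with run G ρ M (map early (u ∷ todo) ++ map late qs) | run-step G ρ M (early u) (map early todo ++ map late qs)
      ... | _ | unmatched = run-early todo qs unique (skip-B (λ _ → refl) (All.tail (fresh e)) e)
      ... | _ | matched s as Ms s≤
        -- Exposes the server being matched as a successor on the right, to be paired with the
        -- successor in the run.
        rewrite #-insert {p = not ∘ insert s M} {not ∘ M} s (cong not (insert-here s M)) (cong not Ms)
                         (λ t t≢s → cong not (sym (insert-there M t≢s))) with serverView s
      ...   | isB b = s≤s (run-early todo qs unique (match-B b Ms s≤ e))
      ...   | isA i with u ≟ i | adj-early-A u i
      ...     | no  _    | eq = contradiction (trans (sym as) eq) λ ()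
      ...     | yes refl | _  = s≤s (run-early todo qs unique (skip-B
                  (λ b → sym (insert-there M (A≢B ∘ sym)))
                  (All.zipWith (λ (u≢i , Mi) → trans (insert-there M (u≢i ∘ sym ∘ A-injective)) Mi)
                    (u∉todo , All.tail (fresh e))) e))

-- Averaging over the rank orders.

module Expectation (k : ℕ) where

  open Counting
  open ServedCount
  open Totals
  open Simulation
  open HardInstance k
  open import Data.Nat using (_+_; _*_; _∸_; _^_; _≤_; _<_; z≤n; s≤s; _<ᵇ_)
  open import Data.Nat.Properties hiding (_≟_)

  transpose-fixes : ∀ {n} {a b c : Fin n} → c ≢ a → c ≢ b → transpose a b c ≡ c
  transpose-fixes {a = a} {b} {c} c≢a c≢b rewrite dec-false (c ≟ a) c≢a | dec-false (c ≟ b) c≢b = refl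

  transpose-left : ∀ {n} (a b : Fin n) → transpose a b a ≡ b
  transpose-left a b rewrite dec-true (a ≟ a) refl = refl

  transpose-natural : ∀ {m n} {e : Fin m → Fin n} → Injective _≡_ _≡_ e → ∀ a b c →
                      transpose (e a) (e b) (e c) ≡ e (transpose a b c)
  transpose-natural {e = e} inj a b c with c ≟ a
  ... | yes refl rewrite dec-true (e c ≟ e c) refl = refl
  ... | no  c≢a rewrite dec-false (e c ≟ e a) (c≢a ∘ inj) with c ≟ b
  ...   | yes refl rewrite dec-true (e c ≟ e c) refl = refl
  ...   | no  c≢b rewrite dec-false (e c ≟ e b) (c≢b ∘ inj) = refl

  -- The truncation is harmless, as `J` never exceeds k by `served-below≤`.
  unserved : List (Fin (suc k)) → (Server → Server) → ℕ
  unserved us ρ = k ∸ J ρ us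

  -- The increment of the recursion: `J ρ (u ∷ us)` is by definition `J ρ us + ⟦ hits u us ρ ⟧`.
  hits : Fin (suc k) → List (Fin (suc k)) → (Server → Server) → Bool
  hits u us ρ = J ρ us <ᵇ below (rank ρ ∘ B) (rank ρ (A u))

  below-ext : ∀ {n} {v w : Fin n → ℕ} → v ≗ w → ∀ {a b} → a ≡ b → below v a ≡ below w b
  below-ext v≗w {a} refl = #-cong (cong (_<ᵇ a) ∘ v≗w)

  J-ext : ∀ us → Extensional (λ ρ → J ρ us)
  J-ext us {f} {g} f≗g = cong served (trans
    (sym (map-∘ us))
    (trans (map-cong (λ u → below-ext (cong toℕ ∘ f≗g ∘ B) (cong toℕ (f≗g (A u)))) us) (map-∘ us)))

  unserved-ext : ∀ us → Extensional (unserved us)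
  unserved-ext us f≗g = cong (k ∸_) (J-ext us f≗g)

  hits-ext : ∀ u us → Extensional (λ ρ → ⟦ hits u us ρ ⟧)
  hits-ext u us f≗g = cong ⟦_⟧ (cong₂ _<ᵇ_ (J-ext us f≗g)
    (below-ext (cong toℕ ∘ f≗g ∘ B) (cong toℕ (f≗g (A u)))))

  module Contest (u : Fin (suc k)) where

    -- Enumerates the set C of the B's and `A u`. With `A u` at index 0, the B's are the positive
    -- indices, and the swap for index 0 changes nothing.
    contestant : Fin (suc k) → Server
    contestant zero    = A u
    contestant (suc j) = B j

    contestant-injective : Injective _≡_ _≡_ contestant
    contestant-injective {zero}  {zero}  eq = refl
    contestant-injective {zero}  {suc j} eq = contradiction eq A≢B
    contestant-injective {suc i} {zero}  eq = contradiction (sym eq) A≢B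
    contestant-injective {suc i} {suc j} eq = cong suc (B-injective eq)

    τ : Fin (suc k) → Server → Server
    τ x = transpose (A u) (contestant x)

    τ-fixes : ∀ x {l} → u ≢ l → τ x (A l) ≡ A l
    τ-fixes zero    u≢l = transpose-fixes (u≢l ∘ sym ∘ A-injective) (u≢l ∘ sym ∘ A-injective)
    τ-fixes (suc j) u≢l = transpose-fixes (u≢l ∘ sym ∘ A-injective) A≢B

    module _ (ρ : Server → Server) where

      v : Fin (suc k) → ℕ
      v = rank ρ ∘ contestant

      w : Fin (suc k) → Fin k → ℕ
      w x = rank (ρ ∘ τ x) ∘ B

      -- After the swap `A u` has the rank `v x`, and the B's have the other k values of `v` in some
      -- order. The count over `v` is therefore reindexed by the transposition of 0 and `x`.
      below-w : ∀ x a → below v a ≡ ⟦ v x <ᵇ a ⟧ + below (w x) a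
      below-w x a = begin
        below v a
          ≡⟨ sum-permute (λ y → ⟦ v y <ᵇ a ⟧) (Perm.transpose zero x) ⟩
        ⟦ v (transpose zero x zero) <ᵇ a ⟧ + sum (λ j → ⟦ v (transpose zero x (suc j)) <ᵇ a ⟧)
          ≡⟨ cong₂ (λ y z → ⟦ v y <ᵇ a ⟧ + z) (transpose-left zero x)
               (sum-cong-≗ λ j → cong (λ s → ⟦ rank ρ s <ᵇ a ⟧)
                 (sym (transpose-natural contestant-injective zero x (suc j)))) ⟩
        ⟦ v x <ᵇ a ⟧ + below (w x) a ∎
        where open ≡-Reasoning

      module _ {us : List (Fin (suc k))} (u∉us : All (u ≢_) us) where

        -- The swap moves the ranks of `A u` and one contestant only. As `u` is not in `us`, the
        -- thresholds of the earlier requests stay the same, and only the values of the B's change.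
        J-τ : ∀ x → J (ρ ∘ τ x) us ≡ served (map (below (w x)) (arrivals ρ us))
        J-τ x = cong (served ∘ map (below (w x)))
          (map-cong-local (All.map (cong (rank ρ) ∘ τ-fixes x) u∉us))

        contest : suc k * sum (λ x → ⟦ hits u us (ρ ∘ τ x) ⟧) ≤ sum (λ x → unserved us (ρ ∘ τ x))
        contest = begin
          suc k * sum (λ x → ⟦ hits u us (ρ ∘ τ x) ⟧)
            ≡⟨ cong (suc k *_) (sum-cong-≗ λ x → cong ⟦_⟧ (cong₂ _<ᵇ_ (J-τ x)
                 (cong (below (w x) ∘ rank ρ) (transpose-left (A u) (contestant x))))) ⟩
          suc k * # (λ x → served (map (below (w x)) (arrivals ρ us)) <ᵇ below (w x) (v x))
            ≤⟨ Exchange.exchange v w below-w (arrivals ρ us) ⟩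
          sum (λ x → k ∸ served (map (below (w x)) (arrivals ρ us)))
            ≡⟨ sum-cong-≗ (λ x → cong (k ∸_) (J-τ x)) ⟨
          sum (λ x → unserved us (ρ ∘ τ x)) ∎
          where open ≤-Reasoning

  N : ℕ
  N = k + suc k

  open Contest using (τ; contestant; contest)

  -- Each of the `suc k` swaps leaves the total unchanged.
  total-contest : ∀ u {F : (Server → Server) → ℕ} → Extensional F →
                  total N (λ ρ → sum (λ x → F (ρ ∘ τ u x))) ≡ suc k * total N F
  total-contest u {F} ext = trans (sumOver-sum (rankOrders N) (λ x ρ → F (ρ ∘ τ u x))) (trans
    (sum-cong-≗ λ x → total-transpose (A u) (contestant u x) ext)
    (sum-const (suc k) (total N F)))

  -- Request `u` takes a B with probability at most E U / d. Summing `contest` over all rank orders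
  -- produces a further factor `suc k` on both sides, which cancels.
  total-hits : ∀ {u us} → All (u ≢_) us →
               suc k * total N (λ ρ → ⟦ hits u us ρ ⟧) ≤ total N (unserved us)
  total-hits {u} {us} u∉us = *-cancelˡ-≤ (suc k) (begin
    suc k * (suc k * total N (λ ρ → ⟦ hits u us ρ ⟧))
      ≡⟨ cong (suc k *_) (total-contest u (hits-ext u us)) ⟨
    suc k * total N (λ ρ → sum (λ x → ⟦ hits u us (ρ ∘ τ u x) ⟧))
      ≡⟨ sumOver-* (rankOrders N) (suc k) _ ⟨
    total N (λ ρ → suc k * sum (λ x → ⟦ hits u us (ρ ∘ τ u x) ⟧))
      ≤⟨ total-mono N (λ ρ _ → contest u ρ u∉us) ⟩
    total N (λ ρ → sum (λ x → unserved us (ρ ∘ τ u x)))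
      ≡⟨ total-contest u (unserved-ext us) ⟩
    suc k * total N (unserved us) ∎)
    where open ≤-Reasoning

  unserved-∷ : ∀ u us ρ → unserved us ρ ≤ unserved (u ∷ us) ρ + ⟦ hits u us ρ ⟧
  unserved-∷ u us ρ = begin
    k ∸ j             ≤⟨ m≤n+m∸n (k ∸ j) h ⟩
    h + (k ∸ j ∸ h)   ≡⟨ cong (h +_) (∸-+-assoc k j h) ⟩
    h + (k ∸ (j + h)) ≡⟨ +-comm h _ ⟩
    k ∸ (j + h) + h   ∎
    where
    open ≤-Reasoning
    j = J ρ us
    h = ⟦ hits u us ρ ⟧

  -- One request shrinks E U by a factor of at least 1 - 1/d; the denominator is cleared.
  total-unserved-∷ : ∀ {u us} → All (u ≢_) us →
                     k * total N (unserved us) ≤ suc k * total N (unserved (u ∷ us))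
  -- With `U` added, the left side is `suc k * U` by definition; the added `U` is matched by the
  -- bound on `suc k * H`.
  total-unserved-∷ {u} {us} u∉us = +-cancelˡ-≤ U _ _ (begin
    U + k * U                    ≤⟨ *-monoʳ-≤ (suc k) (total-mono N (λ ρ _ → unserved-∷ u us ρ)) ⟩
    suc k * total N (λ ρ → unserved (u ∷ us) ρ + ⟦ hits u us ρ ⟧)
                                 ≡⟨ cong (suc k *_) (sumOver-+ (rankOrders N) _ _) ⟩
    suc k * (U′ + H)             ≡⟨ *-distribˡ-+ (suc k) U′ H ⟩
    suc k * U′ + suc k * H       ≤⟨ +-monoʳ-≤ (suc k * U′) (total-hits u∉us) ⟩
    suc k * U′ + U               ≡⟨ +-comm (suc k * U′) U ⟩
    U + suc k * U′               ∎)
    where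
    open ≤-Reasoning
    U U′ H : ℕ
    U  = total N (unserved us)
    U′ = total N (unserved (u ∷ us))
    H  = total N (λ ρ → ⟦ hits u us ρ ⟧)

  -- The estimate E U ≥ k (1 - 1/d)^e for e distinct requests, with denominators cleared. It starts
  -- from U = k before any request.
  total-unserved : ∀ {us} → Unique us →
    k ^ length us * (k * numOrders G) ≤ suc k ^ length us * total N (unserved us)
  total-unserved []  = *-monoʳ-≤ 1 (≤-reflexive (sym (sumOver-const (rankOrders N) k)))
  total-unserved {u ∷ us} (u∉us ∷ unique) = begin
    k * k ^ e * (k * numOrders G)                    ≡⟨ *-assoc k (k ^ e) _ ⟩
    k * (k ^ e * (k * numOrders G))                  ≤⟨ *-monoʳ-≤ k (total-unserved unique) ⟩
    k * (suc k ^ e * total N (unserved us))          ≡⟨ swap-factors k (suc k ^ e) _ ⟩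
    suc k ^ e * (k * total N (unserved us))          ≤⟨ *-monoʳ-≤ (suc k ^ e) (total-unserved-∷ u∉us) ⟩
    suc k ^ e * (suc k * total N (unserved (u ∷ us))) ≡⟨ swap-factors (suc k ^ e) (suc k) _ ⟩
    suc k * (suc k ^ e * total N (unserved (u ∷ us))) ≡⟨ *-assoc (suc k) (suc k ^ e) _ ⟨
    suc k * suc k ^ e * total N (unserved (u ∷ us))  ∎
    where
    open ≤-Reasoning
    e = length us
    swap-factors : ∀ x y z → x * (y * z) ≡ y * (x * z)
    swap-factors x y z = trans (sym (*-assoc x y z)) (trans (cong (_* z) (*-comm x y)) (*-assoc y x z))

  tabulate-+ : ∀ {X : Set} m {n} (f : Fin (m + n) → X) →
               tabulate f ≡ tabulate (f ∘ (_↑ˡ n)) ++ tabulate (f ∘ (m ↑ʳ_))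
  tabulate-+ zero    f = refl
  tabulate-+ (suc m) f = cong (f zero ∷_) (tabulate-+ m (f ∘ suc))

  allFin-requests : allFin (suc k + k) ≡ map early (allFin (suc k)) ++ map late (allFin k)
  allFin-requests = trans (tabulate-+ (suc k) id)
    (sym (cong₂ _++_ (map-tabulate id early) (map-tabulate id late)))

  -- Reversed because `J` expects the latest request first; this is the list that `run-early`
  -- accumulates.
  serving-order : List (Fin (suc k))
  serving-order = reverse (allFin (suc k))

  -- `run-early` is started with all 2k + 1 servers free. Adding `J` to both sides undoes the
  -- subtraction in `unserved`.
  ALG-bound : ∀ ρ → Injective _≡_ _≡_ ρ → rankingALG G ρ + unserved serving-order ρ ≤ suc k + k
  ALG-bound ρ inj = +-cancelʳ-≤ (J ρ serving-order) _ _ (begin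
    rankingALG G ρ + (k ∸ J ρ serving-order) + J ρ serving-order
      ≡⟨ +-assoc (rankingALG G ρ) _ _ ⟩
    rankingALG G ρ + (k ∸ J ρ serving-order + J ρ serving-order)
      ≡⟨ cong (rankingALG G ρ +_) (m∸n+n≡m (served-below≤ (rank ρ ∘ B) (arrivals ρ serving-order))) ⟩
    rankingALG G ρ + k
      ≡⟨ cong (_+ k) (trans (rankingALG≡run G ρ) (cong (run G ρ (λ _ → false)) allFin-requests)) ⟩
    run G ρ (λ _ → false) (map early (allFin (suc k)) ++ map late (allFin k)) + k
      ≤⟨ run-early ρ inj (allFin (suc k)) (allFin k) (allFin⁺ (suc k)) initially ⟩
    # {k + suc k} (λ _ → true) + J ρ serving-order
      ≡⟨ cong (_+ J ρ serving-order) (trans (#-true (k + suc k)) (+-suc k k)) ⟩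
    suc k + k + J ρ serving-order ∎)
    where
    open ≤-Reasoning
    initially : Early ρ inj (λ _ → false) [] (allFin (suc k))
    initially = record
      { few     = ≤-reflexive (#-false k)
      ; initial = λ _ _ ()
      ; fresh   = All.universal (λ _ → refl) _
      }

  -- This is E ALG ≤ (2d - 1) - k (1 - 1/d)^d, multiplied by d^d and by the number of rank orders.
  totalALG-bound :
    suc k ^ suc k * totalALG G + k ^ suc k * (k * numOrders G) ≤ suc k ^ suc k * ((suc k + k) * numOrders G)
  totalALG-bound = begin
    D * totalALG G + k ^ suc k * (k * numOrders G)
      ≤⟨ +-monoʳ-≤ (D * totalALG G) (subst (λ e → k ^ e * (k * numOrders G) ≤ suc k ^ e * total N U)
           length-serving-order (total-unserved unique)) ⟩
    D * totalALG G + D * total N U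
      ≡⟨ *-distribˡ-+ D (totalALG G) _ ⟨
    D * (totalALG G + total N U)
      ≡⟨ cong (D *_) (sumOver-+ (rankOrders N) (rankingALG G) U) ⟨
    D * total N (λ ρ → rankingALG G ρ + U ρ)
      ≤⟨ *-monoʳ-≤ D (total-mono N ALG-bound) ⟩
    D * total N (λ _ → suc k + k)
      ≡⟨ cong (D *_) (sumOver-const (rankOrders N) (suc k + k)) ⟩
    D * ((suc k + k) * numOrders G) ∎
    where
    open ≤-Reasoning
    D = suc k ^ suc k
    U = unserved serving-order
    length-serving-order : length serving-order ≡ suc k
    length-serving-order = trans (length-reverse (allFin (suc k))) (length-tabulate {n = suc k} id)
    unique : Unique serving-order
    unique = Unique-resp-↭ (↭⇒↭ₛ (↭-sym (↭-reverse (allFin (suc k))))) (allFin⁺ (suc k))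
      where open import Data.List.Relation.Binary.Permutation.Setoid.Properties (setoid (Fin (suc k))) using (Unique-resp-↭)

-- Passage to the rationals and the ratio γ.

open import Data.Integer using (+_)
open import Data.Rational using (ℚ; 0ℚ; 1ℚ; _+_; _*_; _-_; -_; _/_; _≤_; _<_; toℚᵘ; fromℚᵘ; Positive)

-- `fromℕ a` and `+ a / suc n` are by definition images under `fromℚᵘ`, so their identities can be
-- checked on unnormalised fractions.
fromℚᵘ-homo-+ : ∀ p q → fromℚᵘ p + fromℚᵘ q ≡ fromℚᵘ (p ℚᵘ.+ q)
fromℚᵘ-homo-+ p q = ℚ.toℚᵘ-injective (begin
  toℚᵘ (fromℚᵘ p + fromℚᵘ q)              ≈⟨ ℚ.toℚᵘ-homo-+ (fromℚᵘ p) (fromℚᵘ q) ⟩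
  toℚᵘ (fromℚᵘ p) ℚᵘ.+ toℚᵘ (fromℚᵘ q)    ≈⟨ ℚᵘ.+-cong (ℚ.toℚᵘ-fromℚᵘ p) (ℚ.toℚᵘ-fromℚᵘ q) ⟩
  p ℚᵘ.+ q                                ≈⟨ ℚ.toℚᵘ-fromℚᵘ (p ℚᵘ.+ q) ⟨
  toℚᵘ (fromℚᵘ (p ℚᵘ.+ q))                ∎)
  where open import Relation.Binary.Reasoning.Setoid ℚᵘ.≃-setoid

fromℚᵘ-homo-* : ∀ p q → fromℚᵘ p * fromℚᵘ q ≡ fromℚᵘ (p ℚᵘ.* q)
fromℚᵘ-homo-* p q = ℚ.toℚᵘ-injective (begin
  toℚᵘ (fromℚᵘ p * fromℚᵘ q)              ≈⟨ ℚ.toℚᵘ-homo-* (fromℚᵘ p) (fromℚᵘ q) ⟩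
  toℚᵘ (fromℚᵘ p) ℚᵘ.* toℚᵘ (fromℚᵘ q)    ≈⟨ ℚᵘ.*-cong (ℚ.toℚᵘ-fromℚᵘ p) (ℚ.toℚᵘ-fromℚᵘ q) ⟩
  p ℚᵘ.* q                                ≈⟨ ℚ.toℚᵘ-fromℚᵘ (p ℚᵘ.* q) ⟨
  toℚᵘ (fromℚᵘ (p ℚᵘ.* q))                ∎)
  where open import Relation.Binary.Reasoning.Setoid ℚᵘ.≃-setoid

fromℕ-+ : ∀ a b → fromℕ (a ℕ.+ b) ≡ fromℕ a + fromℕ b
fromℕ-+ a b = sym (trans (fromℚᵘ-homo-+ (mkℚᵘ (+ a) 0) (mkℚᵘ (+ b) 0))
  (cong fromℚᵘ (cong₂ (λ x y → mkℚᵘ (x ℤ.+ y) 0) (ℤ.*-identityʳ (+ a)) (ℤ.*-identityʳ (+ b)))))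

fromℕ-* : ∀ a b → fromℕ (a ℕ.* b) ≡ fromℕ a * fromℕ b
fromℕ-* a b = sym (trans (fromℚᵘ-homo-* (mkℚᵘ (+ a) 0) (mkℚᵘ (+ b) 0))
  (cong (λ x → fromℚᵘ (mkℚᵘ x 0)) (sym (ℤ.pos-* a b))))

fromℕ-mono : ∀ {a b} → a ℕ.≤ b → fromℕ a ≤ fromℕ b
fromℕ-mono {a} {b} a≤b = ℚ.toℚᵘ-cancel-≤ (begin
  toℚᵘ (fromℕ a)  ≃⟨ ℚ.toℚᵘ-fromℚᵘ (mkℚᵘ (+ a) 0) ⟩
  mkℚᵘ (+ a) 0    ≤⟨ *≤* (ℤ.*-monoʳ-≤-nonNeg (+ 1) (ℤ.+≤+ a≤b)) ⟩
  mkℚᵘ (+ b) 0    ≃⟨ ℚ.toℚᵘ-fromℚᵘ (mkℚᵘ (+ b) 0) ⟨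
  toℚᵘ (fromℕ b)  ∎)
  where open ℚᵘ.≤-Reasoning

fromℕ-*-/ : ∀ a n → fromℕ (suc n) * (+ a / suc n) ≡ fromℕ a
fromℕ-*-/ a n = trans (fromℚᵘ-homo-* (mkℚᵘ (+ suc n) 0) (mkℚᵘ (+ a) n)) 
  (ℚ.fromℚᵘ-cong {mkℚᵘ (+ suc n) 0 ℚᵘ.* mkℚᵘ (+ a) n} {mkℚᵘ (+ a) 0} (*≡* eq))
  where
  eq : (+ suc n ℤ.* + a) ℤ.* + 1 ≡ + a ℤ.* + (1 ℕ.* suc n)
  eq = trans (ℤ.*-identityʳ _) (trans (ℤ.*-comm (+ suc n) (+ a)) (cong (λ x → + a ℤ.* + x) (sym (ℕ.*-identityˡ (suc n)))))

fromℕ-^-powℚ : ∀ k e → fromℕ (suc k ℕ.^ e) * powℚ (+ k / suc k) e ≡ fromℕ (k ℕ.^ e)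
fromℕ-^-powℚ k zero    = ℚ.*-identityʳ (fromℕ 1)
fromℕ-^-powℚ k (suc e) = begin
  fromℕ (suc k ℕ.* suc k ℕ.^ e) * (x * p)         ≡⟨ cong (_* (x * p)) (fromℕ-* (suc k) (suc k ℕ.^ e)) ⟩
  fromℕ (suc k) * fromℕ (suc k ℕ.^ e) * (x * p)   ≡⟨ interchange (fromℕ (suc k)) _ x p ⟩
  fromℕ (suc k) * x * (fromℕ (suc k ℕ.^ e) * p)   ≡⟨ cong₂ _*_ (fromℕ-*-/ k k) (fromℕ-^-powℚ k e) ⟩
  fromℕ k * fromℕ (k ℕ.^ e)                       ≡⟨ fromℕ-* k (k ℕ.^ e) ⟨
  fromℕ (k ℕ.* k ℕ.^ e)                           ∎
  where
  open ≡-Reasoning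
  open import Algebra.Bundles using (CommutativeMonoid)
  open import Algebra.Properties.CommutativeSemigroup (CommutativeMonoid.commutativeSemigroup ℚ.*-1-commutativeMonoid) using (interchange)
  x = + k / suc k
  p = powℚ x e

-- Dividing by d^d, the number of rank orders and OPT = 2k + 1 turns the loss k (1 - 1/d)^d into the
-- loss in γ. The inequality is kept multiplied out, so that only the positive factor `D` is
-- cancelled.
ratio-bound : ∀ k T N →
  suc k ℕ.^ suc k ℕ.* T ℕ.+ k ℕ.^ suc k ℕ.* (k ℕ.* N) ℕ.≤ suc k ℕ.^ suc k ℕ.* ((suc k ℕ.+ k) ℕ.* N) →
  fromℕ T ≤ γ (suc k) * fromℕ (N ℕ.* (suc k ℕ.+ k))
ratio-bound k T N bound = ℚ.*-cancelˡ-≤-pos D {{positive}} (begin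
  D * fromℕ T                                       ≡⟨ solve 2 (λ x y → x := x :+ y :- y) refl (D * fromℕ T) X ⟩
  D * fromℕ T + X - X                               ≤⟨ ℚ.+-monoˡ-≤ (- X) bound′ ⟩
  D * (s * fromℕ N) - X                             ≡⟨ cong (λ x → D * (s * fromℕ N) - x)
                                                         (cong₂ (λ x y → x * (y * fromℕ N)) (sym (fromℕ-^-powℚ k (suc k))) (sym s*q)) ⟩
  D * (s * fromℕ N) - D * p * (s * q * fromℕ N)     ≡⟨ solve 5 (λ D s N p q → D :* (s :* N) :- D :* p :* (s :* q :* N)
                                                         := D :* ((con 1ℚ :- q :* p) :* (N :* s))) refl D s (fromℕ N) p q ⟩
  D * (γ (suc k) * (fromℕ N * s))                   ≡⟨ cong (λ x → D * (γ (suc k) * x)) (fromℕ-* N (suc k ℕ.+ k)) ⟨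
  D * (γ (suc k) * fromℕ (N ℕ.* (suc k ℕ.+ k)))     ∎)
  where
  open ℚ.≤-Reasoning
  open import Data.Rational.Solver using (module +-*-Solver)
  open +-*-Solver
  D s p q X : ℚ
  D = fromℕ (suc k ℕ.^ suc k)
  s = fromℕ (suc k ℕ.+ k)
  p = powℚ (+ k / suc k) (suc k)
  q = + k / suc (2 ℕ.* k)
  X = fromℕ (k ℕ.^ suc k) * (fromℕ k * fromℕ N)
  positive : Positive D
  positive = ℚ.normalize-pos (suc k ℕ.^ suc k) 1 {{_}} {{ℕ.m^n≢0 (suc k) (suc k)}}
  s*q : s * q ≡ fromℕ k
  -- The denominator `suc (2 ℕ.* k)` computes to `suc (k ℕ.+ (k ℕ.+ 0))`, hence the rewriting of
  -- `suc k ℕ.+ k`.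
  s*q = trans (cong (λ x → fromℕ (suc (k ℕ.+ x)) * q) (sym (ℕ.+-identityʳ k))) (fromℕ-*-/ k (2 ℕ.* k))
  bound′ : D * fromℕ T + X ≤ D * (s * fromℕ N)
  bound′ = subst₂ _≤_
    (trans (fromℕ-+ (suc k ℕ.^ suc k ℕ.* T) _) (cong₂ _+_ (fromℕ-* (suc k ℕ.^ suc k) T)
      (trans (fromℕ-* (k ℕ.^ suc k) (k ℕ.* N)) (cong (fromℕ (k ℕ.^ suc k) *_) (fromℕ-* k N)))))
    (trans (fromℕ-* (suc k ℕ.^ suc k) _) (cong (D *_) (fromℕ-* (suc k ℕ.+ k) N)))
    (fromℕ-mono bound)

theorem3p1 : (d : ℕ) → 2 ℕ.≤ d → (ε : ℚ) → 0ℚ < ε →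
    Σ Instance λ G → Σ ℕ λ k →
    IsRegular d G × IsOPT G k × 1 ℕ.≤ k ×
    fromℕ (totalALG G) ≤ (γ d + ε) * fromℕ (numOrders G ℕ.* k)
-- The same instance serves every ε: its ratio is at most γ, which is then weakened to γ + ε.
theorem3p1 (suc k) _ ε 0<ε = G , suc k ℕ.+ k , regular , optimum , ℕ.s≤s ℕ.z≤n , (begin
  fromℕ (totalALG G)                                          ≤⟨ ratio-bound k (totalALG G) (numOrders G) totalALG-bound ⟩
  γ (suc k) * fromℕ (numOrders G ℕ.* (suc k ℕ.+ k))           ≤⟨ ℚ.*-monoʳ-≤-nonNeg (fromℕ (numOrders G ℕ.* (suc k ℕ.+ k))) {{ℚ.normalize-nonNeg (numOrders G ℕ.* (suc k ℕ.+ k)) 1}} γ≤γ+ε ⟩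
  (γ (suc k) + ε) * fromℕ (numOrders G ℕ.* (suc k ℕ.+ k))     ∎)
  where
  open HardInstance k
  open Expectation k
  open ℚ.≤-Reasoning
  γ≤γ+ε : γ (suc k) ≤ γ (suc k) + ε
  γ≤γ+ε = subst (_≤ γ (suc k) + ε) (ℚ.+-identityʳ (γ (suc k))) (ℚ.+-monoʳ-≤ (γ (suc k)) (ℚ.<⇒≤ 0<ε))
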